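{- Let $S\ge 2$ and $\alpha_1,\dots,\alpha_S>0$. As $n\to\infty$ through values with $m_j=\alpha_j n$ positive integers for all $j$, and with $M=m_1+\dots+m_S$, $$B(m_1,\dots,m_S)\sim\frac{m_1\cdots m_S}{(M-m_1)\cdots(M-m_S)}\cdot\frac{M!}{m_1!\cdots m_S!}.$$
   Context: For positive integers $m_1,\dots,m_S$, $B(m_1,\dots,m_S)=\sum_{\ell_1=0}^{m_1-1}\cdots\sum_{\ell_S=0}^{m_S-1}\frac{(\ell_1+\dots+\ell_S)!}{\ell_1!\cdots\ell_S!}$; equivalently $B(m_1,\dots,m_S)=\sum_{k_1=1}^{m_1}\cdots\sum_{k_S=1}^{m_S}\binom{m_1}{k_1}\cdots\binom{m_S}{k_S}E(k_1-1,\dots,k_S-1)$ where $E$ is the block derangement number. -}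

module Defs where

open import Data.Integer.Base using (+_)
open import Data.Nat.Base as ℕ using (ℕ; zero; suc; _!)
import Data.Nat.Properties as ℕ
open import Data.Product.Base using (∃-syntax; _×_; _,_; proj₁; proj₂)
open import Data.Rational.Base hiding (_≃_)
open import Data.Rational.Properties
open import Data.Vec.Base using (Vec; []; _∷_; map; sum; foldr′)
open import Data.Vec.Relation.Unary.All using (All; []; _∷_)
import Data.Vec.Relation.Unary.All.Properties as All
open import Relation.Binary.PropositionalEquality

-- Real numbers as Cauchy sequences of rationals; equality of reals is _≃_, not _≡_.
record ℝ : Set where
  field
    seq    : ℕ → ℚ
    cauchy : ∀ ε → 0ℚ < ε → ∃[ N ] ∀ i j → N ℕ.≤ i → N ℕ.≤ j → ∣ seq i - seq j ∣ < ε

open ℝ public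

infix 4 _≃_

_≃_ : ℝ → ℝ → Set
x ≃ y = ∀ ε → 0ℚ < ε → ∃[ N ] ∀ i → N ℕ.≤ i → ∣ seq x i - seq y i ∣ < ε

0<ℝ_ : ℝ → Set
0<ℝ x = ∃[ δ ] 0ℚ < δ × ∃[ N ] ∀ i → N ℕ.≤ i → δ ≤ seq x i

fromℕ : ℕ → ℝ
fromℕ n .seq _ = + n / 1
fromℕ n .cauchy ε 0<ε = 0 , λ _ _ _ _ →
  subst (_< ε) (sym (cong ∣_∣ (+-inverseʳ (+ n / 1)))) 0<ε

infixr 7 _·_

_·_ : ℕ → ℝ → ℝ
(n · x) .seq i = (+ n / 1) * seq x i
(zero · x) .cauchy ε 0<ε = 0 , λ i j _ _ →
  subst (_< ε) (sym (cong ∣_∣ (cong₂ _-_ (*-zeroˡ (seq x i)) (*-zeroˡ (seq x j))))) 0<ε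
(suc n · x) .cauchy ε 0<ε = proj₁ near , λ i j N≤i N≤j →
  subst₂ _<_ (scale (seq x i) (seq x j)) c*[ε/c]≡ε (*-monoʳ-<-pos c (proj₂ near i j N≤i N≤j))
  where
  c = + suc n / 1
  instance
    c>0 : Positive c
    c>0 = normalize-pos (suc n) 1
    c≢0 : NonZero c
    c≢0 = pos⇒nonZero c
    1/c>0 : Positive (1/ c)
    1/c>0 = 1/pos⇒pos c
    ε>0 : Positive ε
    ε>0 = positive 0<ε
  near = cauchy x (1/ c * ε) (positive⁻¹ (1/ c * ε) {{pos*pos⇒pos (1/ c) ε}})
  c*[ε/c]≡ε : c * (1/ c * ε) ≡ ε
  c*[ε/c]≡ε = trans (sym (*-assoc c (1/ c) ε)) (trans (cong (_* ε) (*-inverseʳ c)) (*-identityˡ ε))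
  scale : ∀ a b → c * ∣ a - b ∣ ≡ ∣ c * a - c * b ∣
  scale a b = begin
    c * ∣ a - b ∣          ≡⟨ cong (_* ∣ a - b ∣) (0≤p⇒∣p∣≡p (<⇒≤ (positive⁻¹ c))) ⟨
    ∣ c ∣ * ∣ a - b ∣      ≡⟨ ∣p*q∣≡∣p∣*∣q∣ c (a - b) ⟨
    ∣ c * (a - b) ∣        ≡⟨ cong ∣_∣ (*-distribˡ-+ c a (- b)) ⟩
    ∣ c * a + c * (- b) ∣  ≡⟨ cong (λ t → ∣ c * a + t ∣) (neg-distribʳ-* c b) ⟨
    ∣ c * a - c * b ∣      ∎
    where open ≡-Reasoning

prod : ∀ {S} → Vec ℕ S → ℕ
prod = foldr′ ℕ._*_ 1

prod≢0 : ∀ {S} {v : Vec ℕ S} → All ℕ.NonZero v → ℕ.NonZero (prod v)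
prod≢0 []       = _
prod≢0 (p ∷ ps) = ℕ.m*n≢0 _ _ {{p}} {{prod≢0 ps}}

prod!≢0 : ∀ {S} (v : Vec ℕ S) → ℕ.NonZero (prod (map _! v))
prod!≢0 []      = _
prod!≢0 (k ∷ v) = ℕ.m*n≢0 _ _ {{k ℕ.!≢0}} {{prod!≢0 v}}

multinomial : ∀ {S} → Vec ℕ S → ℚ
multinomial ℓ = (+ (sum ℓ !) / prod (map _! ℓ)) {{prod!≢0 ℓ}}

∑< : ℕ → (ℕ → ℚ) → ℚ
∑< zero    f = 0ℚ
∑< (suc n) f = ∑< n f + f n

-- The iterated sum of f (ℓ₁ , … , ℓ_S) over 0 ≤ ℓⱼ < mⱼ.
∑box : ∀ {S} → Vec ℕ S → (Vec ℕ S → ℚ) → ℚ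
∑box []       f = f []
∑box (m ∷ ms) f = ∑< m λ ℓ → ∑box ms λ ℓs → f (ℓ ∷ ℓs)

B : ∀ {S} → Vec ℕ S → ℚ
B m = ∑box m multinomial

-- The entries M - mⱼ, where M = m₁ + … + m_S; the truncated subtraction is exact.
complements : ∀ {S} → Vec ℕ S → Vec ℕ S
complements m = map (sum m ℕ.∸_) m

sum>0 : ∀ {S} {m : Vec ℕ S} → 1 ℕ.≤ S → All ℕ.NonZero m → 0 ℕ.< sum m
sum>0 {m = k ∷ m} _ (k≢0 ∷ _) =
  ℕ.≤-trans (ℕ.>-nonZero⁻¹ k {{k≢0}}) (ℕ.m≤m+n k (sum m))

all-∸ : ∀ {S} M (m : Vec ℕ S) → All (ℕ._< M) m → All (λ k → ℕ.NonZero (M ℕ.∸ k)) m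
all-∸ M []      []         = []
all-∸ M (k ∷ m) (k<M ∷ lt) = ℕ.>-nonZero (ℕ.m<n⇒0<n∸m k<M) ∷ all-∸ M m lt

all≤ : ∀ {S} c M (m : Vec ℕ S) → 0 ℕ.< c → c ℕ.+ sum m ℕ.≤ M → All (ℕ._< M) m
all≤ c M []      0<c le = []
all≤ c M (k ∷ m) 0<c le =
  ℕ.≤-trans (ℕ.+-mono-≤ 0<c (ℕ.m≤m+n k (sum m))) le
  ∷ all≤ (c ℕ.+ k) M m (ℕ.≤-trans 0<c (ℕ.m≤m+n c k))
      (subst (ℕ._≤ M) (sym (ℕ.+-assoc c k (sum m))) le)

complements≢0 : ∀ {S} {m : Vec ℕ S} → 2 ℕ.≤ S → All ℕ.NonZero m → All ℕ.NonZero (complements m)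
complements≢0 {m = k ∷ m} (ℕ.s≤s 1≤S) (k≢0 ∷ m≢0) = All.map⁺ (all-∸ (k ℕ.+ sum m) (k ∷ m)
  ( subst (ℕ._< k ℕ.+ sum m) (ℕ.+-identityʳ k) (ℕ.+-monoʳ-< k (sum>0 1≤S m≢0))
  ∷ all≤ k (k ℕ.+ sum m) m (ℕ.>-nonZero⁻¹ k {{k≢0}}) ℕ.≤-refl))

-- (m₁ ⋯ m_S) / ((M - m₁) ⋯ (M - m_S)); for S = 1 the denominator would be 0.
prefactor : ∀ {S} → 2 ℕ.≤ S → (m : Vec ℕ S) → All ℕ.NonZero m → ℚ
prefactor 2≤S m m≢0 =
  (+ prod m / prod (complements m)) {{prod≢0 (complements≢0 2≤S m≢0)}}

mainTerm : ∀ {S} → 2 ℕ.≤ S → (m : Vec ℕ S) → All ℕ.NonZero m → ℚ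
mainTerm 2≤S m m≢0 = prefactor 2≤S m m≢0 * multinomial m

mainTerm≢0 : ∀ {S} (2≤S : 2 ℕ.≤ S) (m : Vec ℕ S) (m≢0 : All ℕ.NonZero m) →
             NonZero (mainTerm 2≤S m m≢0)
mainTerm≢0 2≤S m m≢0 = pos⇒nonZero (p * q) {{pos*pos⇒pos p {{p>0}} q {{q>0}}}}
  where
  p = prefactor 2≤S m m≢0
  q = multinomial m
  p>0 : Positive p
  p>0 = normalize-pos (prod m) (prod (complements m))
          {{prod≢0 (complements≢0 2≤S m≢0)}} {{prod≢0 m≢0}}
  q>0 : Positive q
  q>0 = normalize-pos (sum m !) (prod (map _! m)) {{prod!≢0 m}} {{sum m ℕ.!≢0}}

{-# OPTIONS --safe #-}

-- Write b(r,ℓ) for the binomial coefficient C(r+ℓ, ℓ). Summing out one variable at a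
-- time uses the exact identity (r+1) ∑_{ℓ<m} b(r,ℓ) = m b(r,m), where r is the sum of all
-- the other variables, so that the factor m/(M-m) of the main term appears up to
-- replacing M-m by r+1. If K is the amount by which the outer variables fall short of
-- their maxima, then r+1 = M-m-K+1, and (M-m)/(r+1) ≤ 1 + K(K+1)/(M-m). Hence the box sum
-- exceeds its main term by a relative error of order (K+1)²/M. This bound survives the
-- next summation because ∑_{ℓ<m} b(r,ℓ) (m-ℓ)(m-ℓ+1)/2 also has a closed form, comparable
-- with (m/M) b(r,m) as soon as r is at least of order M. At K = 0 the relative error is
-- O(1/M). From below, r+1 ≤ M-m+1 loses only a factor 1 - O(1/M) for each variable.
module Submission where

open import Defs
open import Data.Fin.Base using (Fin; zero; suc)
import Data.Integer.Properties as ℤ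
open import Data.Nat.Base as ℕ using (ℕ)
open import Data.Nat.Coprimality using (1-coprimeTo) renaming (sym to coprime-sym)
import Data.Nat.DivMod as ℕ
import Data.Nat.Properties as ℕ
open import Data.Nat.Tactic.RingSolver using (solve-∀)
open import Data.Product.Base using (∃-syntax; _×_; _,_; proj₁; proj₂)
open import Data.Rational.Base using (ℚ; 0ℚ; 1ℚ; _<_; _-_; _÷_; ∣_∣)
open import Data.Rational.Solver using (module +-*-Solver)
open import Data.Rational.Unnormalised.Base using (mkℚᵘ; *≡*)
import Data.Rational.Unnormalised.Properties as ℚᵘ
open import Data.Sum.Base using (inj₁; inj₂)
open import Data.Vec.Base using (Vec; lookup; []; _∷_; map; sum)
open import Data.Vec.Relation.Unary.All as All using (All; []; _∷_)
import Data.Vec.Relation.Unary.All.Properties as All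
open import Relation.Binary.PropositionalEquality

module Naturals where
  open import Data.Nat.Base using (zero; suc; _+_; _*_; _∸_; _≤_; _!; z≤n; s≤s; NonZero)
  open import Data.Nat.Combinatorics using (_C_; k![n∸k]!∣n!; nCk≡n!/k![n-k]!)

  -- Finite sums of natural numbers.

  ∑ : ℕ → (ℕ → ℕ) → ℕ
  ∑ zero    f = 0
  ∑ (suc n) f = ∑ n f + f n

  ∑-cong : ∀ n {f g : ℕ → ℕ} → (∀ ℓ → suc ℓ ≤ n → f ℓ ≡ g ℓ) → ∑ n f ≡ ∑ n g
  ∑-cong zero    eq = refl
  ∑-cong (suc n) eq =
    cong₂ _+_ (∑-cong n λ ℓ ℓ<n → eq ℓ (ℕ.m≤n⇒m≤1+n ℓ<n)) (eq n ℕ.≤-refl)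

  ∑-mono : ∀ n {f g : ℕ → ℕ} → (∀ ℓ → suc ℓ ≤ n → f ℓ ≤ g ℓ) → ∑ n f ≤ ∑ n g
  ∑-mono zero    le = z≤n
  ∑-mono (suc n) le =
    ℕ.+-mono-≤ (∑-mono n λ ℓ ℓ<n → le ℓ (ℕ.m≤n⇒m≤1+n ℓ<n)) (le n ℕ.≤-refl)

  ∑-*ˡ : ∀ c n f → c * ∑ n f ≡ ∑ n λ ℓ → c * f ℓ
  ∑-*ˡ c zero    f = ℕ.*-zeroʳ c
  ∑-*ˡ c (suc n) f =
    trans (ℕ.*-distribˡ-+ c (∑ n f) (f n)) (cong (_+ c * f n) (∑-*ˡ c n f))

  ∑-+ : ∀ n f g → ∑ n (λ ℓ → f ℓ + g ℓ) ≡ ∑ n f + ∑ n g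
  ∑-+ zero    f g = refl
  ∑-+ (suc n) f g =
    trans (cong (_+ (f n + g n)) (∑-+ n f g)) (interchange (∑ n f) (∑ n g) (f n) (g n))
    where
    interchange : ∀ a b c d → a + b + (c + d) ≡ a + c + (b + d)
    interchange = solve-∀

  -- Binomial and multinomial coefficients, and their sums over boxes.

  binom : ℕ → ℕ → ℕ
  binom r ℓ = (r + ℓ) C ℓ

  binom-! : ∀ r ℓ → binom r ℓ * (ℓ ! * r !) ≡ (r + ℓ) !
  binom-! r ℓ = subst (λ k → binom r ℓ * (ℓ ! * k !) ≡ (r + ℓ) !) (ℕ.m+n∸n≡m r ℓ)
    (trans (cong (_* (ℓ ! * (r + ℓ ∸ ℓ) !)) (nCk≡n!/k![n-k]! ℓ≤r+ℓ))
           (ℕ.m/n*n≡m {{ℓ ℕ.!* (r + ℓ ∸ ℓ) !≢0}} (k![n∸k]!∣n! ℓ≤r+ℓ)))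
    where
    ℓ≤r+ℓ = ℕ.m≤n+m ℓ r

  -- Both sides become `(r + suc ℓ) !` after multiplication by `ℓ ! * r !`, a nonzero factor that is
  -- then cancelled.
  binom-absorb : ∀ r ℓ → suc ℓ * binom r (suc ℓ) ≡ suc (r + ℓ) * binom r ℓ
  binom-absorb r ℓ = ℕ.*-cancelʳ-≡ _ _ (ℓ ! * r !) {{ℓ ℕ.!* r !≢0}} (begin
    suc ℓ * binom r (suc ℓ) * (ℓ ! * r !)    ≡⟨ shift (suc ℓ) (binom r (suc ℓ)) (ℓ !) (r !) ⟩
    binom r (suc ℓ) * (suc ℓ ! * r !)        ≡⟨ binom-! r (suc ℓ) ⟩
    (r + suc ℓ) !                            ≡⟨ cong _! (ℕ.+-suc r ℓ) ⟩
    suc (r + ℓ) * (r + ℓ) !                  ≡⟨ cong (suc (r + ℓ) *_) (binom-! r ℓ) ⟨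
    suc (r + ℓ) * (binom r ℓ * (ℓ ! * r !))  ≡⟨ ℕ.*-assoc (suc (r + ℓ)) (binom r ℓ) _ ⟨
    suc (r + ℓ) * binom r ℓ * (ℓ ! * r !)    ∎)
    where
    open ≡-Reasoning
    shift : ∀ s b x y → s * b * (x * y) ≡ b * (s * x * y)
    shift = solve-∀

  -- (a + |ℓ|)! / (a! ℓ₁! ⋯ ℓ_S!)
  multi : ∀ {S} → ℕ → Vec ℕ S → ℕ
  multi a []       = 1
  multi a (ℓ ∷ ℓs) = binom a ℓ * multi (a + ℓ) ℓs

  multi-! : ∀ {S} a (ℓ : Vec ℕ S) → multi a ℓ * (prod (map _! ℓ) * a !) ≡ (a + sum ℓ) !
  multi-! a []       = trans (simp (a !)) (cong _! (sym (ℕ.+-identityʳ a)))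
    where
    simp : ∀ x → 1 * (1 * x) ≡ x
    simp = solve-∀
  multi-! a (ℓ ∷ ℓs) = begin
    binom a ℓ * multi (a + ℓ) ℓs * (ℓ ! * prod (map _! ℓs) * a !)
      ≡⟨ rearrange (binom a ℓ) (multi (a + ℓ) ℓs) (ℓ !) (prod (map _! ℓs)) (a !) ⟩
    multi (a + ℓ) ℓs * (prod (map _! ℓs) * (binom a ℓ * (ℓ ! * a !)))
      ≡⟨ cong (λ t → multi (a + ℓ) ℓs * (prod (map _! ℓs) * t)) (binom-! a ℓ) ⟩
    multi (a + ℓ) ℓs * (prod (map _! ℓs) * (a + ℓ) !)
      ≡⟨ multi-! (a + ℓ) ℓs ⟩
    (a + ℓ + sum ℓs) !
      ≡⟨ cong _! (ℕ.+-assoc a ℓ (sum ℓs)) ⟩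
    (a + (ℓ + sum ℓs)) ! ∎
    where
    open ≡-Reasoning
    rearrange : ∀ b t x p y → b * t * (x * p * y) ≡ t * (p * (b * (x * y)))
    rearrange = solve-∀

  -- The index `ℓ` is adjoined first on the left and last on the right. The right-hand form makes
  -- the sum over `ℓ` computable, since `a + sum m` does not depend on `ℓ`.
  multi-cons : ∀ {S} a ℓ (m : Vec ℕ S) →
               binom a ℓ * multi (a + ℓ) m ≡ multi a m * binom (a + sum m) ℓ
  multi-cons a ℓ m = ℕ.*-cancelʳ-≡ _ _ (ℓ ! * (P * a !)) {{nz}} (begin
    multi a (ℓ ∷ m) * (ℓ ! * (P * a !))
      ≡⟨ cong (multi a (ℓ ∷ m) *_) (ℕ.*-assoc (ℓ !) P (a !)) ⟨
    multi a (ℓ ∷ m) * (ℓ ! * P * a !)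
      ≡⟨ multi-! a (ℓ ∷ m) ⟩
    (a + (ℓ + sum m)) !
      ≡⟨ cong _! (swap a ℓ (sum m)) ⟩
    (a + sum m + ℓ) !
      ≡⟨ binom-! (a + sum m) ℓ ⟨
    binom (a + sum m) ℓ * (ℓ ! * (a + sum m) !)
      ≡⟨ cong (λ t → binom (a + sum m) ℓ * (ℓ ! * t)) (multi-! a m) ⟨
    binom (a + sum m) ℓ * (ℓ ! * (multi a m * (P * a !)))
      ≡⟨ rearrange (binom (a + sum m) ℓ) (ℓ !) (multi a m) (P * a !) ⟩
    multi a m * binom (a + sum m) ℓ * (ℓ ! * (P * a !)) ∎)
    where
    open ≡-Reasoning
    P = prod (map _! m)
    nz : NonZero (ℓ ! * (P * a !))
    nz = ℕ.m*n≢0 _ _ {{ℓ ℕ.!≢0}} {{ℕ.m*n≢0 _ _ {{prod!≢0 m}} {{a ℕ.!≢0}}}}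
    swap : ∀ x y z → x + (y + z) ≡ x + z + y
    swap = solve-∀
    rearrange : ∀ b x t y → b * (x * (t * y)) ≡ t * b * (x * y)
    rearrange = solve-∀

  -- This is the sum of `multi a` over the box, with each binomial factor pulled out of the inner
  -- sums; `a` accumulates the indices already fixed.
  boxSum : ∀ {S} → ℕ → Vec ℕ S → ℕ
  boxSum a []       = 1
  boxSum a (m ∷ ms) = ∑ m λ ℓ → binom a ℓ * boxSum (a + ℓ) ms

  -- Closed forms for binomial sums with polynomial weights.

  tri : ℕ → ℕ
  tri zero    = 0
  tri (suc k) = tri k + suc k

  -- The hockey-stick identity, whose value is C(r+m, r+1), with denominators cleared. In the
  -- induction step the coefficients add up to `suc (r + m)`, and absorption yields the next
  -- binomial.
  hockey₀ : ∀ r m → suc r * ∑ m (binom r) ≡ m * binom r m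
  hockey₀ r zero    = ℕ.*-zeroʳ r
  hockey₀ r (suc m) = begin
    suc r * (∑ m (binom r) + binom r m)        ≡⟨ ℕ.*-distribˡ-+ (suc r) (∑ m (binom r)) (binom r m) ⟩
    suc r * ∑ m (binom r) + suc r * binom r m  ≡⟨ cong (_+ suc r * binom r m) (hockey₀ r m) ⟩
    m * binom r m + suc r * binom r m          ≡⟨ collect r m (binom r m) ⟩
    suc (r + m) * binom r m                    ≡⟨ binom-absorb r m ⟨
    suc m * binom r (suc m)                    ∎
    where
    open ≡-Reasoning
    collect : ∀ r m b → m * b + suc r * b ≡ suc (r + m) * b
    collect = solve-∀

  -- Raising the upper limit by one adds the increment `v (suc m ∸ ℓ)` to every weight, and the new
  -- term at `ℓ = m` starts from `w 0 ≡ 0`. Sums weighted by `w` thus reduce to sums weighted by the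
  -- increments of `w`.
  ∑-weight-suc : ∀ (w v f : ℕ → ℕ) m → w 0 ≡ 0 → (∀ k → w (suc k) ≡ w k + v (suc k)) →
                 ∑ (suc m) (λ ℓ → f ℓ * w (suc m ∸ ℓ)) ≡
                 ∑ m (λ ℓ → f ℓ * w (m ∸ ℓ)) + ∑ (suc m) (λ ℓ → f ℓ * v (suc m ∸ ℓ))
  ∑-weight-suc w v f m w0 ws = begin
    ∑ (suc m) (λ ℓ → f ℓ * w (suc m ∸ ℓ))
      ≡⟨ ∑-cong (suc m) split ⟩
    ∑ (suc m) (λ ℓ → f ℓ * w (m ∸ ℓ) + f ℓ * v (suc m ∸ ℓ))
      ≡⟨ ∑-+ (suc m) _ _ ⟩
    W + f m * w (m ∸ m) + V
      ≡⟨ cong (λ t → W + t + V) last≡0 ⟩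
    W + 0 + V
      ≡⟨ cong (_+ V) (ℕ.+-identityʳ W) ⟩
    W + V ∎
    where
    open ≡-Reasoning
    W = ∑ m (λ ℓ → f ℓ * w (m ∸ ℓ))
    V = ∑ (suc m) (λ ℓ → f ℓ * v (suc m ∸ ℓ))
    last≡0 : f m * w (m ∸ m) ≡ 0
    last≡0 = trans (cong (f m *_) (trans (cong w (ℕ.n∸n≡0 m)) w0)) (ℕ.*-zeroʳ (f m))
    split : ∀ ℓ → suc ℓ ≤ suc m →
            f ℓ * w (suc m ∸ ℓ) ≡ f ℓ * w (m ∸ ℓ) + f ℓ * v (suc m ∸ ℓ)
    split ℓ (s≤s ℓ≤m) rewrite ℕ.+-∸-assoc 1 ℓ≤m =
      trans (cong (f ℓ *_) (ws (m ∸ ℓ))) (ℕ.*-distribˡ-+ (f ℓ) _ _)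

  -- The weight grows by 1, so each induction step adds a `hockey₀` sum. The sum equals C(r+m+1,
  -- r+2).
  hockey₁ : ∀ r m → suc r * suc (suc r) * ∑ m (λ ℓ → binom r ℓ * (m ∸ ℓ)) ≡
                    m * suc (r + m) * binom r m
  hockey₁ r zero    = ℕ.*-zeroʳ (suc r * suc (suc r))
  hockey₁ r (suc m) = begin
    suc r * suc (suc r) * ∑ (suc m) (λ ℓ → binom r ℓ * (suc m ∸ ℓ))
      ≡⟨ cong (suc r * suc (suc r) *_)
           (∑-weight-suc (λ k → k) (λ _ → 1) (binom r) m refl (λ k → sym (ℕ.+-comm k 1))) ⟩
    suc r * suc (suc r) * (V + ∑ (suc m) (λ ℓ → binom r ℓ * 1))
      ≡⟨ cong (λ t → suc r * suc (suc r) * (V + t)) (∑-cong (suc m) λ ℓ _ → ℕ.*-identityʳ (binom r ℓ)) ⟩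
    suc r * suc (suc r) * (V + ∑ (suc m) (binom r))
      ≡⟨ expand (suc r) (suc (suc r)) V (∑ (suc m) (binom r)) ⟩
    suc r * suc (suc r) * V + suc (suc r) * (suc r * ∑ (suc m) (binom r))
      ≡⟨ cong₂ (λ s t → s + suc (suc r) * t) (hockey₁ r m) (hockey₀ r (suc m)) ⟩
    m * suc (r + m) * binom r m + suc (suc r) * (suc m * binom r (suc m))
      ≡⟨ cong (_+ suc (suc r) * (suc m * binom r (suc m)))
           (trans (ℕ.*-assoc m (suc (r + m)) (binom r m)) (cong (m *_) (sym (binom-absorb r m)))) ⟩
    m * (suc m * binom r (suc m)) + suc (suc r) * (suc m * binom r (suc m))
      ≡⟨ collect r m (binom r (suc m)) ⟩
    suc m * suc (r + suc m) * binom r (suc m) ∎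
    where
    open ≡-Reasoning
    V = ∑ m (λ ℓ → binom r ℓ * (m ∸ ℓ))
    expand : ∀ x y v s → x * y * (v + s) ≡ x * y * v + y * (x * s)
    expand = solve-∀
    collect : ∀ r m b → m * (suc m * b) + suc (suc r) * (suc m * b) ≡ suc m * suc (r + suc m) * b
    collect = solve-∀

  -- The increments of `tri` are the linear weight, so each step adds a `hockey₁` sum. The sum
  -- equals C(r+m+2, r+3).
  hockey₂ : ∀ r m → suc r * suc (suc r) * suc (suc (suc r)) * ∑ m (λ ℓ → binom r ℓ * tri (m ∸ ℓ)) ≡
                    m * suc (r + m) * suc (suc (r + m)) * binom r m
  hockey₂ r zero    = ℕ.*-zeroʳ (suc r * suc (suc r) * suc (suc (suc r)))
  hockey₂ r (suc m) = begin
    R * suc (suc (suc r)) * ∑ (suc m) (λ ℓ → binom r ℓ * tri (suc m ∸ ℓ))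
      ≡⟨ cong (R * suc (suc (suc r)) *_)
           (∑-weight-suc tri (λ k → k) (binom r) m refl (λ k → refl)) ⟩
    R * suc (suc (suc r)) * (V + W)
      ≡⟨ expand R (suc (suc (suc r))) V W ⟩
    R * suc (suc (suc r)) * V + suc (suc (suc r)) * (R * W)
      ≡⟨ cong₂ (λ s t → s + suc (suc (suc r)) * t) (hockey₂ r m) (hockey₁ r (suc m)) ⟩
    m * suc (r + m) * suc (suc (r + m)) * binom r m
      + suc (suc (suc r)) * (suc m * suc (r + suc m) * binom r (suc m))
      ≡⟨ cong (_+ suc (suc (suc r)) * (suc m * suc (r + suc m) * binom r (suc m)))
           (trans (regroup m (suc (r + m)) (suc (suc (r + m))) (binom r m))
                  (cong (m * suc (suc (r + m)) *_) (sym (binom-absorb r m)))) ⟩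
    m * suc (suc (r + m)) * (suc m * binom r (suc m))
      + suc (suc (suc r)) * (suc m * suc (r + suc m) * binom r (suc m))
      ≡⟨ collect r m (binom r (suc m)) ⟩
    suc m * suc (r + suc m) * suc (suc (r + suc m)) * binom r (suc m) ∎
    where
    open ≡-Reasoning
    R = suc r * suc (suc r)
    V = ∑ m (λ ℓ → binom r ℓ * tri (m ∸ ℓ))
    W = ∑ (suc m) (λ ℓ → binom r ℓ * (suc m ∸ ℓ))
    expand : ∀ x y v s → x * y * (v + s) ≡ x * y * v + y * (x * s)
    expand = solve-∀
    regroup : ∀ m x y b → m * x * y * b ≡ m * y * (x * b)
    regroup = solve-∀
    collect : ∀ r m b → m * suc (suc (r + m)) * (suc m * b)
                          + suc (suc (suc r)) * (suc m * suc (r + suc m) * b)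
                        ≡ suc m * suc (r + suc m) * suc (suc (r + suc m)) * b
    collect = solve-∀

  2*tri : ∀ k → 2 * tri k ≡ k * suc k
  2*tri zero    = refl
  2*tri (suc k) = begin
    2 * (tri k + suc k)      ≡⟨ ℕ.*-distribˡ-+ 2 (tri k) (suc k) ⟩
    2 * tri k + 2 * suc k    ≡⟨ cong (_+ 2 * suc k) (2*tri k) ⟩
    k * suc k + 2 * suc k    ≡⟨ collect k ⟩
    suc k * suc (suc k)      ∎
    where
    open ≡-Reasoning
    collect : ∀ k → k * suc k + 2 * suc k ≡ suc k * suc (suc k)
    collect = solve-∀

  -- Upper and lower bounds for the box sum.

  sq : ℕ → ℕ
  sq K = suc K * suc K

  -- Combines `suc (K + k) ≤ suc K * suc k` with `suc k ≤ k + k`. It separates the outer shortfall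
  -- `K` from the shortfall `k` of the current variable, leaving a weight that `hockey₂` can sum.
  sq-+ : ∀ K k → 1 ≤ k → sq (K + k) ≤ 4 * sq K * tri k
  sq-+ K k 1≤k = begin
    suc (K + k) * suc (K + k)              ≤⟨ ℕ.*-mono-≤ le le ⟩
    suc K * suc k * (suc K * suc k)        ≡⟨ regroup (suc K) (suc k) ⟩
    sq K * suc k * suc k                   ≤⟨ ℕ.*-monoʳ-≤ (sq K * suc k) (ℕ.+-monoˡ-≤ k 1≤k) ⟩
    sq K * suc k * (k + k)                 ≡⟨ regroup′ (sq K) k ⟩
    2 * sq K * (k * suc k)                 ≡⟨ cong (2 * sq K *_) (2*tri k) ⟨
    2 * sq K * (2 * tri k)                 ≡⟨ regroup″ (sq K) (tri k) ⟩
    4 * sq K * tri k                       ∎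
    where
    open ℕ.≤-Reasoning
    regroup : ∀ x y → x * y * (x * y) ≡ x * x * y * y
    regroup = solve-∀
    regroup′ : ∀ q k → q * suc k * (k + k) ≡ 2 * q * (k * suc k)
    regroup′ = solve-∀
    regroup″ : ∀ q t → 2 * q * (2 * t) ≡ 4 * q * t
    regroup″ = solve-∀
    expand : ∀ K k → suc K * suc k ≡ suc (K + k) + K * k
    expand = solve-∀
    le : suc (K + k) ≤ suc K * suc k
    le = ℕ.≤-trans (ℕ.m≤m+n (suc (K + k)) (K * k)) (ℕ.≤-reflexive (sym (expand K k)))

  -- In the closed form of `hockey₂`, the factors `M`, `suc (r + m)` and `suc (suc (r + m))` are at
  -- most `D` times `suc r`, `suc (suc r)` and `suc (suc (suc r))`, whence the cube of `D`.
  tail-bound : ∀ {D M} r m → r + m ≤ M → M ≤ D * r →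
               M * ∑ m (λ ℓ → binom r ℓ * tri (m ∸ ℓ)) ≤ D * D * D * (m * binom r m)
  -- `D = 0` forces `M = 0`, and the left side vanishes.
  tail-bound {zero}  {zero} r m r+m≤M M≤Dr = z≤n
  tail-bound {suc d} {M}    r m r+m≤M M≤Dr = ℕ.*-cancelˡ-≤ R (begin
    R * (M * V)
      ≡⟨ swap R M V ⟩
    M * (R * V)
      ≡⟨ cong (M *_) (hockey₂ r m) ⟩
    M * (m * suc (r + m) * suc (suc (r + m)) * binom r m)
      ≤⟨ ℕ.*-monoʳ-≤ M (ℕ.*-monoˡ-≤ (binom r m)
           (ℕ.*-mono-≤ (ℕ.*-monoʳ-≤ m (s≤s r+m≤M)) (s≤s (s≤s r+m≤M)))) ⟩
    M * (m * suc M * suc (suc M) * binom r m)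
      ≤⟨ ℕ.*-mono-≤ M≤ (ℕ.*-monoˡ-≤ (binom r m) (ℕ.*-mono-≤ (ℕ.*-monoʳ-≤ m M+1≤) M+2≤)) ⟩
    D * suc r * (m * (D * suc (suc r)) * (D * suc (suc (suc r))) * binom r m)
      ≡⟨ regroup D (suc r) (suc (suc r)) (suc (suc (suc r))) m (binom r m) ⟩
    R * (D * D * D * (m * binom r m)) ∎)
    where
    open ℕ.≤-Reasoning
    D = suc d
    R = suc r * suc (suc r) * suc (suc (suc r))
    V = ∑ m (λ ℓ → binom r ℓ * tri (m ∸ ℓ))
    swap : ∀ x y z → x * (y * z) ≡ y * (x * z)
    swap = solve-∀
    regroup : ∀ D x y z m b → D * x * (m * (D * y) * (D * z) * b) ≡ x * y * z * (D * D * D * (m * b))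
    regroup = solve-∀
    step : ∀ {x y} → x ≤ D * y → suc x ≤ D * suc y
    step {x} {y} x≤Dy = begin
      suc x      ≤⟨ s≤s x≤Dy ⟩
      1 + D * y  ≤⟨ ℕ.+-monoˡ-≤ (D * y) (s≤s (z≤n {d})) ⟩
      D + D * y  ≡⟨ ℕ.*-suc D y ⟨
      D * suc y  ∎
    M≤ : M ≤ D * suc r
    M≤ = ℕ.≤-trans M≤Dr (ℕ.*-monoʳ-≤ D (ℕ.n≤1+n r))
    M+1≤ : suc M ≤ D * suc (suc r)
    M+1≤ = step M≤
    M+2≤ : suc (suc M) ≤ D * suc (suc (suc r))
    M+2≤ = step M+1≤

  -- The constant in the relative error `excess D S * sq K / M` with `S` variables still to sum. The
  -- summand `D` comes from replacing `M ∸ m` by `suc r`, the other one from summing the inner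
  -- errors.
  excess : ℕ → ℕ → ℕ
  excess D zero    = 0
  excess D (suc S) = D + 4 * excess D S * (D * D * D)

  -- Any remaining entry `k` gives `M ≤ D * k ≤ D * (a + sum ms)`, as `tail-bound` requires. With no
  -- entry left, both sides vanish because `excess D 0` is zero.
  excess-tail : ∀ {S} {D M} (ms : Vec ℕ S) a m → a + sum ms + m ≤ M → All (λ k → M ≤ D * k) ms →
                excess D S * (M * ∑ m (λ ℓ → binom (a + sum ms) ℓ * tri (m ∸ ℓ))) ≤
                excess D S * (D * D * D * (m * binom (a + sum ms) m))
  excess-tail []       a m le []        = z≤n
  excess-tail {suc S} {D} {M} (k ∷ ms) a m le (M≤Dk ∷ _) =
    ℕ.*-monoʳ-≤ (excess D (suc S)) (tail-bound {D} {M} (a + (k + sum ms)) m le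
      (ℕ.≤-trans M≤Dk (ℕ.*-monoʳ-≤ D (ℕ.≤-trans (ℕ.m≤m+n k (sum ms)) (ℕ.m≤n+m (k + sum ms) a)))))

  -- With x = r + 1: MN ≤ Mx + MK and MK ≤ DNK ≤ D(x + K)K ≤ Dx(K + 1)².
  denominator-bound : ∀ {D} M N K r → N ≤ suc r + K → M ≤ D * N →
                      M * N ≤ suc r * (M + D * sq K)
  denominator-bound {D} M N K r N≤x+K M≤DN = begin
    M * N
      ≤⟨ ℕ.*-monoʳ-≤ M N≤x+K ⟩
    M * (x + K)
      ≡⟨ ℕ.*-distribˡ-+ M x K ⟩
    M * x + M * K
      ≤⟨ ℕ.+-monoʳ-≤ (M * x) (ℕ.*-monoˡ-≤ K (ℕ.≤-trans M≤DN (ℕ.*-monoʳ-≤ D N≤x+K))) ⟩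
    M * x + D * (x + K) * K
      ≤⟨ ℕ.+-monoʳ-≤ (M * x) (ℕ.≤-trans (ℕ.m≤m+n _ _) (ℕ.≤-reflexive (sym (expand D r K)))) ⟩
    M * x + D * (x * sq K)
      ≡⟨ collect x M D (sq K) ⟩
    x * (M + D * sq K) ∎
    where
    open ℕ.≤-Reasoning
    x = suc r
    expand : ∀ D r K → D * (suc r * (suc K * suc K)) ≡
             D * (suc r + K) * K + (D * (suc r * K) + D * suc r + D * (r * K * K))
    expand = solve-∀
    collect : ∀ x M D q → M * x + D * (x * q) ≡ x * (M + D * q)
    collect = solve-∀

  -- Induction on the remaining variables, with `M` fixed. Fixing `ℓ` raises the shortfall to
  -- `K + (m ∸ ℓ)`; after `sq-+` splits the inner error, the sum over `ℓ` falls into a leading part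
  -- `V₀` and a `tri`-weighted part `V₂`.
  boxSum-upper : ∀ {S} {D M} (ms : Vec ℕ S) a K → K + (a + sum ms) ≡ M →
          All (λ m → M ≤ D * m) ms → All (λ m → M ≤ D * (M ∸ m)) ms →
          M * (prod (map (M ∸_) ms) * boxSum a ms) ≤
          prod ms * multi a ms * (M + excess D S * sq K)
  boxSum-upper {M = M} [] a K eq [] [] = ℕ.≤-reflexive (simp M (sq K))
    where
    simp : ∀ M q → M * (1 * 1) ≡ 1 * 1 * (M + 0 * q)
    simp = solve-∀
  boxSum-upper {suc S} {D} {M} (m ∷ ms) a K eq (_ ∷ big) (M≤DN ∷ bigᶜ) = begin
    M * (N * P * G′)
      ≡⟨ regroup₁ M N P G′ ⟩
    N * (M * P * G′)
      ≡⟨ cong (N *_) (∑-*ˡ (M * P) m _) ⟩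
    N * ∑ m (λ ℓ → M * P * (binom a ℓ * boxSum (a + ℓ) ms))
      ≤⟨ ℕ.*-monoʳ-≤ N (∑-mono m term) ⟩
    N * ∑ m (λ ℓ → pT * (M * f ℓ + 4 * sq K * E * (f ℓ * tri (m ∸ ℓ))))
      ≡⟨ cong (N *_) (trans (sym (∑-*ˡ pT m _)) (cong (pT *_) (trans (∑-+ m _ _)
           (cong₂ _+_ (sym (∑-*ˡ M m f)) (sym (∑-*ˡ (4 * sq K * E) m _)))))) ⟩
    N * (pT * (M * V₀ + 4 * sq K * E * V₂))
      ≡⟨ regroup₂ N pT M V₀ (sq K) E V₂ ⟩
    pT * (M * N * V₀ + 4 * sq K * (E * (N * V₂)))
      ≤⟨ ℕ.*-monoʳ-≤ pT (ℕ.+-mono-≤ head tail) ⟩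
    pT * ((M + D * sq K) * (m * f m) + 4 * sq K * (E * (D * D * D * (m * f m))))
      ≡⟨ regroup₃ p (multi a ms) M D (sq K) m (f m) E ⟩
    m * p * (multi a ms * f m) * (M + excess D (suc S) * sq K)
      ≡⟨ cong (λ t → m * p * t * (M + excess D (suc S) * sq K)) (multi-cons a m ms) ⟨
    m * p * multi a (m ∷ ms) * (M + excess D (suc S) * sq K) ∎
    where
    open ℕ.≤-Reasoning
    r  = a + sum ms
    f  = binom r
    N  = M ∸ m
    P  = prod (map (M ∸_) ms)
    p  = prod ms
    pT = p * multi a ms
    E  = excess D S
    G′ = boxSum a (m ∷ ms)
    V₀ = ∑ m f
    V₂ = ∑ m (λ ℓ → f ℓ * tri (m ∸ ℓ))

    total : K + r + m ≡ M
    total = trans (rotate K a (sum ms) m) eq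
      where
      rotate : ∀ K a s m → K + (a + s) + m ≡ K + (a + (m + s))
      rotate = solve-∀

    N≡K+r : N ≡ K + r
    N≡K+r = trans (cong (_∸ m) (sym total)) (ℕ.m+n∸n≡m (K + r) m)

    -- The closed form evaluates `suc r * V₀`, whereas the product of complements supplies `N * V₀`;
    -- trading `N` for `suc r` costs the term `D * sq K`.
    head : M * N * V₀ ≤ (M + D * sq K) * (m * f m)
    head = begin
      M * N * V₀
        ≤⟨ ℕ.*-monoˡ-≤ V₀ (denominator-bound {D} M N K r N≤ M≤DN) ⟩
      suc r * (M + D * sq K) * V₀
        ≡⟨ trans (cong (_* V₀) (ℕ.*-comm (suc r) (M + D * sq K))) (ℕ.*-assoc (M + D * sq K) (suc r) V₀) ⟩
      (M + D * sq K) * (suc r * V₀)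
        ≡⟨ cong ((M + D * sq K) *_) (hockey₀ r m) ⟩
      (M + D * sq K) * (m * f m) ∎
      where
      N≤ : N ≤ suc r + K
      N≤ = ℕ.≤-trans (ℕ.≤-reflexive (trans N≡K+r (ℕ.+-comm K r))) (ℕ.n≤1+n (r + K))

    -- Bounding `N` by `M` is affordable, since this part is already of the order of the error.
    tail : 4 * sq K * (E * (N * V₂)) ≤ 4 * sq K * (E * (D * D * D * (m * f m)))
    tail = ℕ.*-monoʳ-≤ (4 * sq K)
      (ℕ.≤-trans (ℕ.*-monoʳ-≤ E (ℕ.*-monoˡ-≤ V₂ (ℕ.m∸n≤m M m)))
                 (excess-tail ms a m r+m≤M big))
      where
      r+m≤M : r + m ≤ M
      r+m≤M = ℕ.≤-trans (ℕ.m≤n+m (r + m) K)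
        (ℕ.≤-reflexive (trans (sym (ℕ.+-assoc K r m)) total))

    term : ∀ ℓ → suc ℓ ≤ m → M * P * (binom a ℓ * boxSum (a + ℓ) ms) ≤
                 pT * (M * f ℓ + 4 * sq K * E * (f ℓ * tri (m ∸ ℓ)))
    term ℓ ℓ<m = begin
      M * P * (binom a ℓ * boxSum (a + ℓ) ms)
        ≡⟨ rg₁ M P (binom a ℓ) (boxSum (a + ℓ) ms) ⟩
      binom a ℓ * (M * (P * boxSum (a + ℓ) ms))
        ≤⟨ ℕ.*-monoʳ-≤ (binom a ℓ) (boxSum-upper ms (a + ℓ) (K + k) total′ big bigᶜ) ⟩
      binom a ℓ * (p * multi (a + ℓ) ms * (M + E * sq (K + k)))
        ≡⟨ rg₂ (binom a ℓ) p (multi (a + ℓ) ms) (M + E * sq (K + k)) ⟩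
      p * (binom a ℓ * multi (a + ℓ) ms) * (M + E * sq (K + k))
        ≡⟨ cong (λ t → p * t * (M + E * sq (K + k))) (multi-cons a ℓ ms) ⟩
      p * (multi a ms * f ℓ) * (M + E * sq (K + k))
        ≤⟨ ℕ.*-monoʳ-≤ (p * (multi a ms * f ℓ)) (ℕ.+-monoʳ-≤ M (ℕ.*-monoʳ-≤ E
             (sq-+ K k (ℕ.m<n⇒0<n∸m ℓ<m)))) ⟩
      p * (multi a ms * f ℓ) * (M + E * (4 * sq K * tri k))
        ≡⟨ rg₃ p (multi a ms) (f ℓ) M E (sq K) (tri k) ⟩
      pT * (M * f ℓ + 4 * sq K * E * (f ℓ * tri k)) ∎
      where
      k = m ∸ ℓ
      total′ : K + k + (a + ℓ + sum ms) ≡ M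
      total′ = trans (shuffle K k a ℓ (sum ms))
        (trans (cong (K + r +_) (ℕ.m∸n+n≡m (ℕ.<⇒≤ ℓ<m))) total)
        where
        shuffle : ∀ K k a ℓ s → K + k + (a + ℓ + s) ≡ K + (a + s) + (k + ℓ)
        shuffle = solve-∀
      rg₁ : ∀ M P b g → M * P * (b * g) ≡ b * (M * (P * g))
      rg₁ = solve-∀
      rg₂ : ∀ b p t y → b * (p * t * y) ≡ p * (b * t) * y
      rg₂ = solve-∀
      rg₃ : ∀ p t b M E q k → p * (t * b) * (M + E * (4 * q * k)) ≡
                              p * t * (M * b + 4 * q * E * (b * k))
      rg₃ = solve-∀

    regroup₁ : ∀ M N P g → M * (N * P * g) ≡ N * (M * P * g)
    regroup₁ = solve-∀
    regroup₂ : ∀ N t M v q E w → N * (t * (M * v + 4 * q * E * w)) ≡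
                                 t * (M * N * v + 4 * q * (E * (N * w)))
    regroup₂ = solve-∀
    regroup₃ : ∀ p t M D q m b E →
      p * t * ((M + D * q) * (m * b) + 4 * q * (E * (D * D * D * (m * b)))) ≡
      m * p * (t * b) * (M + (D + 4 * E * (D * D * D)) * q)
    regroup₃ = solve-∀

  -- Each variable contributes `suc r ≤ suc N`, and turning `suc N` back into `N` costs `D` in the
  -- leading factor, so `S` variables cost `S * D`. When `M ≤ S * D`, truncated subtraction makes
  -- the left side zero.
  boxSum-lower : ∀ {S} {D M} (ms : Vec ℕ S) a → a + sum ms ≤ M →
          All (λ m → M ≤ D * (M ∸ m)) ms →
          (M ∸ S * D) * (prod ms * multi a ms) ≤ M * (prod (map (M ∸_) ms) * boxSum a ms)
  boxSum-lower [] a le [] = ℕ.≤-refl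
  boxSum-lower {suc S} {D} {M} (m ∷ ms) a le (M≤DN ∷ bigᶜ) = begin
    (M ∸ (D + S * D)) * (m * p * multi a (m ∷ ms))
      ≡⟨ cong₂ (λ s t → s * (m * p * t)) M∸≡y∸D (multi-cons a m ms) ⟩
    (y ∸ D) * (m * p * (multi a ms * f m))
      ≡⟨ regroup₁ (y ∸ D) m p (multi a ms) (f m) ⟩
    (y ∸ D) * (m * f m) * pT
      ≡⟨ cong (λ t → (y ∸ D) * t * pT) (hockey₀ r m) ⟨
    (y ∸ D) * (suc r * V₀) * pT
      ≤⟨ ℕ.*-monoˡ-≤ pT (ℕ.*-monoʳ-≤ (y ∸ D) (ℕ.*-monoˡ-≤ V₀ (s≤s r≤N))) ⟩
    (y ∸ D) * (suc N * V₀) * pT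
      ≡⟨ cong (_* pT) (ℕ.*-assoc (y ∸ D) (suc N) V₀) ⟨
    (y ∸ D) * suc N * V₀ * pT
      ≤⟨ ℕ.*-monoˡ-≤ pT (ℕ.*-monoˡ-≤ V₀ shrink) ⟩
    y * N * V₀ * pT
      ≡⟨ regroup₂ y N V₀ pT ⟩
    N * (y * pT * V₀)
      ≡⟨ cong (N *_) (∑-*ˡ (y * pT) m f) ⟩
    N * ∑ m (λ ℓ → y * pT * f ℓ)
      ≤⟨ ℕ.*-monoʳ-≤ N (∑-mono m term) ⟩
    N * ∑ m (λ ℓ → M * P * (binom a ℓ * boxSum (a + ℓ) ms))
      ≡⟨ cong (N *_) (∑-*ˡ (M * P) m _) ⟨
    N * (M * P * boxSum a (m ∷ ms))
      ≡⟨ regroup₃ N M P (boxSum a (m ∷ ms)) ⟩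
    M * (N * P * boxSum a (m ∷ ms)) ∎
    where
    open ℕ.≤-Reasoning
    r  = a + sum ms
    f  = binom r
    N  = M ∸ m
    P  = prod (map (M ∸_) ms)
    p  = prod ms
    pT = p * multi a ms
    V₀ = ∑ m f
    y  = M ∸ S * D

    M∸≡y∸D : M ∸ (D + S * D) ≡ y ∸ D
    M∸≡y∸D = trans (cong (M ∸_) (ℕ.+-comm D (S * D))) (sym (ℕ.∸-+-assoc M (S * D) D))

    r≤N : r ≤ N
    r≤N = ℕ.m+n≤o⇒m≤o∸n r (ℕ.≤-trans (ℕ.≤-reflexive (rotate a (sum ms) m)) le)
      where
      rotate : ∀ a s m → a + s + m ≡ a + (m + s)
      rotate = solve-∀

    -- The extra copy of `y ∸ D` is absorbed by `D * N`, because `y ∸ D ≤ M ≤ D * N`.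
    shrink : (y ∸ D) * suc N ≤ y * N
    shrink with ℕ.≤-total y D
    ... | inj₁ y≤D = subst (λ t → t * suc N ≤ y * N) (sym (ℕ.m≤n⇒m∸n≡0 y≤D)) z≤n
    ... | inj₂ D≤y = begin
      (y ∸ D) * suc N            ≡⟨ ℕ.*-suc (y ∸ D) N ⟩
      (y ∸ D) + (y ∸ D) * N      ≤⟨ ℕ.+-monoˡ-≤ ((y ∸ D) * N) y∸D≤DN ⟩
      D * N + (y ∸ D) * N        ≡⟨ ℕ.*-distribʳ-+ N D (y ∸ D) ⟨
      (D + (y ∸ D)) * N          ≡⟨ cong (_* N) (ℕ.m+[n∸m]≡n D≤y) ⟩
      y * N                      ∎
      where
      y∸D≤DN : y ∸ D ≤ D * N
      y∸D≤DN = ℕ.≤-trans (ℕ.m∸n≤m y D) (ℕ.≤-trans (ℕ.m∸n≤m M (S * D)) M≤DN)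

    term : ∀ ℓ → suc ℓ ≤ m → y * pT * f ℓ ≤ M * P * (binom a ℓ * boxSum (a + ℓ) ms)
    term ℓ ℓ<m = begin
      y * (p * multi a ms) * f ℓ
        ≡⟨ rg₁ y p (multi a ms) (f ℓ) ⟩
      y * p * (multi a ms * f ℓ)
        ≡⟨ cong (y * p *_) (multi-cons a ℓ ms) ⟨
      y * p * (binom a ℓ * multi (a + ℓ) ms)
        ≡⟨ rg₂ y p (binom a ℓ) (multi (a + ℓ) ms) ⟩
      binom a ℓ * (y * (p * multi (a + ℓ) ms))
        ≤⟨ ℕ.*-monoʳ-≤ (binom a ℓ) (boxSum-lower ms (a + ℓ) le′ bigᶜ) ⟩
      binom a ℓ * (M * (P * boxSum (a + ℓ) ms))
        ≡⟨ rg₃ (binom a ℓ) M P (boxSum (a + ℓ) ms) ⟩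
      M * P * (binom a ℓ * boxSum (a + ℓ) ms) ∎
      where
      le′ : a + ℓ + sum ms ≤ M
      le′ = ℕ.≤-trans (ℕ.≤-reflexive (ℕ.+-assoc a ℓ (sum ms)))
        (ℕ.≤-trans (ℕ.+-monoʳ-≤ a (ℕ.+-monoˡ-≤ (sum ms) (ℕ.<⇒≤ ℓ<m))) le)
      rg₁ : ∀ y p t b → y * (p * t) * b ≡ y * p * (t * b)
      rg₁ = solve-∀
      rg₂ : ∀ y p b t → y * p * (b * t) ≡ b * (y * (p * t))
      rg₂ = solve-∀
      rg₃ : ∀ b M P g → b * (M * (P * g)) ≡ M * P * (b * g)
      rg₃ = solve-∀

    regroup₁ : ∀ z m p t b → z * (m * p * (t * b)) ≡ z * (m * b) * (p * t)
    regroup₁ = solve-∀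
    regroup₂ : ∀ y N v t → y * N * v * t ≡ N * (y * t * v)
    regroup₂ = solve-∀
    regroup₃ : ∀ N M P g → N * (M * P * g) ≡ M * (N * P * g)
    regroup₃ = solve-∀

  -- Entries of comparable size, and the two-sided estimate.

  all≤sum : ∀ {S} (m : Vec ℕ S) → All (_≤ sum m) m
  all≤sum []      = []
  all≤sum (k ∷ m) =
    ℕ.m≤m+n k (sum m) ∷ All.map (λ l≤s → ℕ.≤-trans l≤s (ℕ.m≤n+m (sum m) k)) (all≤sum m)

  -- The complement of an entry contains another entry, available because `S ≥ 2`: the second entry
  -- for the head, and the head for all the others.
  complement-bound : ∀ {S} {n c} (m : Vec ℕ S) → 2 ≤ S → All (λ k → n ≤ c * k) m →
                     All (λ k → n ≤ c * (sum m ∸ k)) m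
  complement-bound {n = n} {c} (k ∷ l ∷ m) _ (n≤ck ∷ n≤cl ∷ _) =
    subst (λ t → n ≤ c * t) (sym (ℕ.m+n∸m≡n k s))
      (ℕ.≤-trans n≤cl (ℕ.*-monoʳ-≤ c (ℕ.m≤m+n l (sum m))))
    ∷ All.map (λ {j} j≤s → ℕ.≤-trans n≤ck (ℕ.*-monoʳ-≤ c
        (ℕ.m+n≤o⇒m≤o∸n k (ℕ.+-monoʳ-≤ k j≤s)))) (all≤sum (l ∷ m))
    where
    s = l + sum m
  complement-bound (_ ∷ []) (s≤s ()) _

  sum-bound : ∀ {S} {b} (m : Vec ℕ S) → All (_≤ b) m → sum m ≤ S * b
  sum-bound []      []         = z≤n
  sum-bound (k ∷ m) (k≤b ∷ le) = ℕ.+-mono-≤ k≤b (sum-bound m le)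

  -- `numerator m / denominator m` is `B m` over the main term, with the product of complements
  -- moved to the numerator.
  numerator : ∀ {S} → Vec ℕ S → ℕ
  numerator m = prod (complements m) * boxSum 0 m

  denominator : ∀ {S} → Vec ℕ S → ℕ
  denominator m = prod m * multi 0 m

  relativeError : ℕ → ℕ → ℕ
  relativeError S c = excess D S + S * D
    where
    -- `sum m ≤ S * (c * n)` and `n ≤ c * k` give `sum m ≤ D * k`, for entries and complements
    -- alike.
    D = S * c * c

  -- No variable is fixed yet, so the box bounds apply with `a = 0`, `K = 0` and `sq K = 1`. The
  -- upper error `E` and the lower error `S * D` are both enlarged to their sum, so that one
  -- constant serves both sides.
  estimate : ∀ {S} {n c} (m : Vec ℕ S) → 2 ≤ S →
             All (λ k → n ≤ c * k) m → All (λ k → k ≤ c * n) m →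
             sum m * numerator m ≤ (sum m + relativeError S c) * denominator m ×
             sum m * denominator m ≤ sum m * numerator m + relativeError S c * denominator m
  estimate {S} {n} {c} m 2≤S n≤cm m≤cn = above , below
    where
    open ℕ.≤-Reasoning
    D = S * c * c
    E = excess D S
    M = sum m
    X = numerator m
    Y = denominator m

    M≤D* : ∀ {k} → n ≤ c * k → M ≤ D * k
    M≤D* {k} n≤ck = begin
      M                ≤⟨ sum-bound m m≤cn ⟩
      S * (c * n)      ≤⟨ ℕ.*-monoʳ-≤ S (ℕ.*-monoʳ-≤ c n≤ck) ⟩
      S * (c * (c * k)) ≡⟨ regroup S c k ⟩
      D * k            ∎
      where
      regroup : ∀ S c k → S * (c * (c * k)) ≡ S * c * c * k
      regroup = solve-∀

    bigᶜ = All.map M≤D* (complement-bound {c = c} m 2≤S n≤cm)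

    above : M * X ≤ (M + (E + S * D)) * Y
    above = begin
      M * X                  ≤⟨ boxSum-upper {D = D} m 0 0 refl (All.map M≤D* n≤cm) bigᶜ ⟩
      Y * (M + E * sq 0)     ≡⟨ simp Y M E ⟩
      (M + E) * Y            ≤⟨ ℕ.*-monoˡ-≤ Y (ℕ.+-monoʳ-≤ M (ℕ.m≤m+n E (S * D))) ⟩
      (M + (E + S * D)) * Y  ∎
      where
      simp : ∀ Y M E → Y * (M + E * 1) ≡ (M + E) * Y
      simp = solve-∀

    below : M * Y ≤ M * X + (E + S * D) * Y
    below = begin
      M * Y
        ≤⟨ ℕ.*-monoˡ-≤ Y (ℕ.m≤n+m∸n M (S * D)) ⟩
      (S * D + (M ∸ S * D)) * Y
        ≡⟨ trans (ℕ.*-distribʳ-+ Y (S * D) (M ∸ S * D)) (ℕ.+-comm (S * D * Y) _) ⟩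
      (M ∸ S * D) * Y + S * D * Y
        ≤⟨ ℕ.+-mono-≤ (boxSum-lower {D = D} m 0 ℕ.≤-refl bigᶜ) (ℕ.*-monoˡ-≤ Y (ℕ.m≤n+m (S * D) E)) ⟩
      M * X + (E + S * D) * Y ∎

module Rationals where
  open Naturals
  open import Data.Integer.Base as ℤ using (+_)
  open import Data.Nat.Base using (zero; suc)
  open import Data.Rational.Base hiding (_≃_)
  open import Data.Rational.Properties

  -- Naturals inside the rationals, and absolute values.

  ι : ℕ → ℚ
  ι n = + n / 1

  -- The fraction `+ n / 1` normalises by a gcd that is stuck on a variable `n`; the explicit form
  -- lets sums, products and comparisons compute.
  ι-canonical : ∀ n → ι n ≡ mkℚ (+ n) 0 (coprime-sym (1-coprimeTo n))
  ι-canonical n = ↥p/↧p≡p (mkℚ (+ n) 0 (coprime-sym (1-coprimeTo n)))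

  ι-+ : ∀ m n → ι (m ℕ.+ n) ≡ ι m + ι n
  ι-+ m n rewrite ι-canonical m | ι-canonical n =
    cong (_/ 1) (sym (cong₂ ℤ._+_ (ℤ.*-identityʳ (+ m)) (ℤ.*-identityʳ (+ n))))

  ι-* : ∀ m n → ι (m ℕ.* n) ≡ ι m * ι n
  ι-* m n rewrite ι-canonical m | ι-canonical n = cong (_/ 1) (ℤ.pos-* m n)

  ι-mono-≤ : ∀ {m n} → m ℕ.≤ n → ι m ≤ ι n
  ι-mono-≤ {m} {n} m≤n rewrite ι-canonical m | ι-canonical n =
    *≤* (ℤ.*-monoʳ-≤-nonNeg (+ 1) (ℤ.+≤+ m≤n))

  ι-mono-< : ∀ {m n} → m ℕ.< n → ι m < ι n
  ι-mono-< {m} {n} m<n rewrite ι-canonical m | ι-canonical n =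
    *<* (ℤ.*-monoʳ-<-pos (+ 1) (ℤ.+<+ m<n))

  ι-cancel-< : ∀ {m n} → ι m < ι n → m ℕ.< n
  ι-cancel-< {m} {n} ιm<ιn = ℕ.≰⇒> λ n≤m → <-irrefl refl (<-≤-trans ιm<ιn (ι-mono-≤ n≤m))

  ι-nonNeg : ∀ n → NonNegative (ι n)
  ι-nonNeg n = normalize-nonNeg n 1

  ι-pos : ∀ n .{{_ : ℕ.NonZero n}} → Positive (ι n)
  ι-pos n = normalize-pos n 1

  /≡ι : ∀ {a b t} .{{_ : ℕ.NonZero b}} → t ℕ.* b ≡ a → + a / b ≡ ι t
  /≡ι {a} {suc b} {t} tb≡a = fromℚᵘ-cong {mkℚᵘ (+ a) b} {mkℚᵘ (+ t) 0}
    (*≡* (trans (ℤ.*-identityʳ (+ a)) (trans (cong +_ (sym tb≡a)) (ℤ.pos-* t (suc b)))))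

  /-*ι : ∀ a b .{{_ : ℕ.NonZero b}} → (+ a / b) * ι b ≡ ι a
  /-*ι a (suc b) = toℚᵘ-injective (ℚᵘ.≃-trans (toℚᵘ-homo-* (+ a / suc b) (ι (suc b)))
    (ℚᵘ.≃-trans (ℚᵘ.*-cong (toℚᵘ-fromℚᵘ (mkℚᵘ (+ a) b)) (toℚᵘ-fromℚᵘ (mkℚᵘ (+ suc b) 0)))
    (ℚᵘ.≃-trans (*≡* (ℤ.*-assoc (+ a) (+ suc b) (+ 1))) (ℚᵘ.≃-sym (toℚᵘ-fromℚᵘ (mkℚᵘ (+ a) 0))))))

  -- The Archimedean property: `p` times its denominator `suc e` is its numerator, a positive
  -- integer.
  1≤p*ι : ∀ p → 0ℚ < p → ∃[ e ] 1ℚ ≤ p * ι (suc e)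
  1≤p*ι p@(mkℚ (+ suc n) d _) _ = d , (begin
    ι 1                          ≤⟨ ι-mono-≤ (ℕ.s≤s (ℕ.z≤n {n})) ⟩
    ι (suc n)                    ≡⟨ /-*ι (suc n) (suc d) ⟨
    (+ suc n / suc d) * ι (suc d) ≡⟨ cong (_* ι (suc d)) (↥p/↧p≡p p) ⟩
    p * ι (suc d)                ∎)
    where open ≤-Reasoning
  1≤p*ι p@(mkℚ (+ 0) d _) 0<p with positive 0<p
  ... | ()
  1≤p*ι p@(mkℚ ℤ.-[1+ n ] d _) 0<p with positive 0<p
  ... | ()

  ∃p≤ι : ∀ p → ∃[ n ] p ≤ ι n
  ∃p≤ι p@(mkℚ (+ n) d _) = n , subst (p ≤_) (sym (ι-canonical n))
    (*≤* {p} {mkℚ (+ n) 0 (coprime-sym (1-coprimeTo n))}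
      (ℤ.*-monoˡ-≤-nonNeg (+ n) (ℤ.+≤+ (ℕ.s≤s (ℕ.z≤n {d})))))
  ∃p≤ι p@(mkℚ ℤ.-[1+ n ] d _) = 0 , <⇒≤ (negative⁻¹ p)

  p≤∣p∣ : ∀ p → p ≤ ∣ p ∣
  p≤∣p∣ p with ≤-total 0ℚ p
  ... | inj₁ 0≤p = ≤-reflexive (sym (0≤p⇒∣p∣≡p 0≤p))
  ... | inj₂ p≤0 = ≤-trans p≤0 (0≤∣p∣ p)

  ∣p-q∣<r⇒p<q+r : ∀ {p q r} → ∣ p - q ∣ < r → p < q + r
  ∣p-q∣<r⇒p<q+r {p} {q} {r} lt = begin-strict
    p            ≡⟨ solve 2 (λ p q → p := q :+ (p :- q)) refl p q ⟩
    q + (p - q)  <⟨ +-monoʳ-< q (≤-<-trans (p≤∣p∣ (p - q)) lt) ⟩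
    q + r        ∎
    where
    open ≤-Reasoning
    open +-*-Solver

  ∣p-q∣≡∣q-p∣ : ∀ p q → ∣ p - q ∣ ≡ ∣ q - p ∣
  ∣p-q∣≡∣q-p∣ p q = trans
    (cong ∣_∣ (solve 2 (λ p q → p :- q := :- (q :- p)) refl p q)) (∣-p∣≡∣p∣ (q - p))
    where open +-*-Solver

  ∣p-q∣<r⇒q<p+r : ∀ {p q r} → ∣ p - q ∣ < r → q < p + r
  ∣p-q∣<r⇒q<p+r {p} {q} {r} lt = ∣p-q∣<r⇒p<q+r (subst (_< r) (∣p-q∣≡∣q-p∣ p q) lt)

  ∣p-q∣<r : ∀ {p q r} → p < q + r → q < p + r → ∣ p - q ∣ < r
  ∣p-q∣<r {p} {q} {r} p<q+r q<p+r with ∣p∣≡p∨∣p∣≡-p (p - q)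
  ... | inj₁ eq = subst (_< r) (sym eq) (begin-strict
    p - q        <⟨ +-monoˡ-< (- q) p<q+r ⟩
    q + r - q    ≡⟨ solve 2 (λ q r → q :+ r :- q := r) refl q r ⟩
    r            ∎)
    where
    open ≤-Reasoning
    open +-*-Solver
  ... | inj₂ eq = subst (_< r) (sym eq) (begin-strict
    - (p - q)    ≡⟨ solve 2 (λ p q → :- (p :- q) := q :- p) refl p q ⟩
    q - p        <⟨ +-monoˡ-< (- p) q<p+r ⟩
    p + r - p    ≡⟨ solve 2 (λ p r → p :+ r :- p := r) refl p r ⟩
    r            ∎)
    where
    open ≤-Reasoning
    open +-*-Solver

  -- The sum `B` and its quotient by the main term, in terms of natural numbers.

  ∑<-ι : ∀ n {f : ℕ → ℚ} {g : ℕ → ℕ} → (∀ ℓ → f ℓ ≡ ι (g ℓ)) → ∑< n f ≡ ι (∑ n g)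
  ∑<-ι zero    eq = refl
  ∑<-ι (suc n) {f} {g} eq = trans (cong₂ _+_ (∑<-ι n eq) (eq n)) (sym (ι-+ (∑ n g) (g n)))

  -- Fixing the first coordinate at `ℓ` multiplies the summand by `binom a ℓ` and adds `ℓ` to `a`;
  -- the constant `c` is there to absorb that factor.
  ∑box-ι : ∀ {S} (ms : Vec ℕ S) c a {f : Vec ℕ S → ℚ} → (∀ ℓs → f ℓs ≡ ι (c ℕ.* multi a ℓs)) →
           ∑box ms f ≡ ι (c ℕ.* boxSum a ms)
  ∑box-ι []       c a eq = eq []
  ∑box-ι (m ∷ ms) c a {f} eq = begin
    ∑box (m ∷ ms) f
      ≡⟨ ∑<-ι m (λ ℓ → ∑box-ι ms (c ℕ.* binom a ℓ) (a ℕ.+ ℓ) λ ℓs →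
           trans (eq (ℓ ∷ ℓs)) (cong ι (sym (ℕ.*-assoc c (binom a ℓ) _)))) ⟩
    ι (∑ m λ ℓ → c ℕ.* binom a ℓ ℕ.* boxSum (a ℕ.+ ℓ) ms)
      ≡⟨ cong ι (∑-cong m λ ℓ _ → ℕ.*-assoc c (binom a ℓ) _) ⟩
    ι (∑ m λ ℓ → c ℕ.* (binom a ℓ ℕ.* boxSum (a ℕ.+ ℓ) ms))
      ≡⟨ cong ι (∑-*ˡ c m _) ⟨
    ι (c ℕ.* boxSum a (m ∷ ms)) ∎
    where open ≡-Reasoning

  multinomial≡ι : ∀ {S} (ℓ : Vec ℕ S) → multinomial ℓ ≡ ι (multi 0 ℓ)
  multinomial≡ι ℓ = /≡ι {t = multi 0 ℓ} {{prod!≢0 ℓ}}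
    (trans (cong (multi 0 ℓ ℕ.*_) (sym (ℕ.*-identityʳ (prod (map ℕ._! ℓ))))) (multi-! 0 ℓ))

  B≡ι : ∀ {S} (m : Vec ℕ S) → B m ≡ ι (boxSum 0 m)
  B≡ι m = trans (∑box-ι m 1 0 λ ℓ → trans (multinomial≡ι ℓ) (cong ι (sym (ℕ.*-identityˡ (multi 0 ℓ)))))
                (cong ι (ℕ.*-identityˡ (boxSum 0 m)))

  multi≢0 : ∀ {S} (m : Vec ℕ S) → ℕ.NonZero (multi 0 m)
  multi≢0 m = ℕ.m*n≢0⇒m≢0 (multi 0 m) {{subst ℕ.NonZero (sym (multi-! 0 m)) (sum m ℕ.!≢0)}}

  denominator≢0 : ∀ {S} (m : Vec ℕ S) → All ℕ.NonZero m → ℕ.NonZero (denominator m)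
  denominator≢0 m m≢0 = ℕ.m*n≢0 _ _ {{prod≢0 m≢0}} {{multi≢0 m}}

  module _ {S} (2≤S : 2 ℕ.≤ S) (m : Vec ℕ S) (m≢0 : All ℕ.NonZero m) where
    ratio : ℚ
    ratio = (B m ÷ mainTerm 2≤S m m≢0) {{mainTerm≢0 2≤S m m≢0}}

    -- The main term times the product of complements is `ι (denominator m)`, and `ratio` times the
    -- main term is `B m`.
    ratio-* : ratio * ι (denominator m) ≡ ι (numerator m)
    ratio-* = begin
      ratio * ι (p ℕ.* t)
        ≡⟨ cong (ratio *_) (trans (ι-* p t) (sym main*)) ⟩
      ratio * (Q * ι P)
        ≡⟨ *-assoc ratio Q (ι P) ⟨
      ratio * Q * ι P
        ≡⟨ cong (_* ι P) (trans (*-assoc (B m) _ Q)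
             (trans (cong (B m *_) (*-inverseˡ Q {{mainTerm≢0 2≤S m m≢0}})) (*-identityʳ (B m)))) ⟩
      B m * ι P
        ≡⟨ trans (cong (_* ι P) (B≡ι m)) (*-comm (ι (boxSum 0 m)) (ι P)) ⟩
      ι P * ι (boxSum 0 m)
        ≡⟨ ι-* P (boxSum 0 m) ⟨
      ι (numerator m) ∎
      where
      open ≡-Reasoning
      Q = mainTerm 2≤S m m≢0
      P = prod (complements m)
      p = prod m
      t = multi 0 m
      main* : Q * ι P ≡ ι p * ι t
      main* = begin
        prefactor 2≤S m m≢0 * multinomial m * ι P
          ≡⟨ solve 3 (λ x y z → x :* y :* z := x :* z :* y) refl (prefactor 2≤S m m≢0) (multinomial m) (ι P) ⟩
        prefactor 2≤S m m≢0 * ι P * multinomial m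
          ≡⟨ cong₂ _*_ (/-*ι p P {{prod≢0 (complements≢0 2≤S m≢0)}}) (multinomial≡ι m) ⟩
        ι p * ι t ∎
        where open +-*-Solver

    -- Dividing `estimate` by the positive `denominator m` puts `ι M * ratio` within `ι C` of `ι M`,
    -- and `ι C < ε * ι M`.
    ratio-bound : ∀ {n c ε} → All (λ k → n ℕ.≤ c ℕ.* k) m → All (λ k → k ℕ.≤ c ℕ.* n) m →
                  ι (relativeError S c) < ε * ι (sum m) → ∣ ratio - 1ℚ ∣ < ε
    ratio-bound {n} {c} {ε} n≤cm m≤cn C<εM = ∣p-q∣<r above below
      where
      open ≤-Reasoning
      open +-*-Solver
      M = sum m
      C = relativeError S c
      X = numerator m
      Y = denominator m
      instance
        M≢0 : ℕ.NonZero M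
        M≢0 = ℕ.>-nonZero (sum>0 (ℕ.<⇒≤ 2≤S) m≢0)
        Y≢0 : ℕ.NonZero Y
        Y≢0 = denominator≢0 m m≢0

      ιMX : ι (M ℕ.* X) ≡ ι M * ratio * ι Y
      ιMX = trans (ι-* M X) (trans (cong (ι M *_) (sym ratio-*)) (sym (*-assoc (ι M) ratio (ι Y))))

      M*ratio≤ : ι M * ratio ≤ ι M + ι C
      M*ratio≤ = *-cancelʳ-≤-pos (ι Y) {{ι-pos Y}} (begin
        ι M * ratio * ι Y     ≡⟨ ιMX ⟨
        ι (M ℕ.* X)           ≤⟨ ι-mono-≤ (proj₁ (estimate {c = c} m 2≤S n≤cm m≤cn)) ⟩
        ι ((M ℕ.+ C) ℕ.* Y)   ≡⟨ ι-* (M ℕ.+ C) Y ⟩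
        ι (M ℕ.+ C) * ι Y     ≡⟨ cong (_* ι Y) (ι-+ M C) ⟩
        (ι M + ι C) * ι Y     ∎)

      ≤M*ratio : ι M ≤ ι M * ratio + ι C
      ≤M*ratio = *-cancelʳ-≤-pos (ι Y) {{ι-pos Y}} (begin
        ι M * ι Y                      ≡⟨ ι-* M Y ⟨
        ι (M ℕ.* Y)                    ≤⟨ ι-mono-≤ (proj₂ (estimate {c = c} m 2≤S n≤cm m≤cn)) ⟩
        ι (M ℕ.* X ℕ.+ C ℕ.* Y)        ≡⟨ ι-+ (M ℕ.* X) (C ℕ.* Y) ⟩
        ι (M ℕ.* X) + ι (C ℕ.* Y)      ≡⟨ cong₂ _+_ ιMX (ι-* C Y) ⟩
        ι M * ratio * ι Y + ι C * ι Y  ≡⟨ *-distribʳ-+ (ι Y) (ι M * ratio) (ι C) ⟨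
        (ι M * ratio + ι C) * ι Y      ∎)

      above : ratio < 1ℚ + ε
      above = *-cancelˡ-<-nonNeg (ι M) {{ι-nonNeg M}} (begin-strict
        ι M * ratio      ≤⟨ M*ratio≤ ⟩
        ι M + ι C        <⟨ +-monoʳ-< (ι M) C<εM ⟩
        ι M + ε * ι M    ≡⟨ solve 2 (λ x e → x :+ e :* x := x :* (con 1ℚ :+ e)) refl (ι M) ε ⟩
        ι M * (1ℚ + ε)   ∎)

      below : 1ℚ < ratio + ε
      below = *-cancelˡ-<-nonNeg (ι M) {{ι-nonNeg M}} (begin-strict
        ι M * 1ℚ                 ≡⟨ *-identityʳ (ι M) ⟩
        ι M                      ≤⟨ ≤M*ratio ⟩
        ι M * ratio + ι C        <⟨ +-monoʳ-< (ι M * ratio) C<εM ⟩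
        ι M * ratio + ε * ι M    ≡⟨ solve 3 (λ x r e → x :* r :+ e :* x := x :* (r :+ e)) refl (ι M) ratio ε ⟩
        ι M * (ratio + ε)        ∎)

  1≤p*ι⇒ι<p*ι : ∀ {p} e C M → 1ℚ ≤ p * ι e → C ℕ.* e ℕ.< M → 0ℚ < p → ι C < p * ι M
  1≤p*ι⇒ι<p*ι {p} e C M 1≤pe Ce<M 0<p = begin-strict
    ι C              ≡⟨ *-identityʳ (ι C) ⟨
    ι C * 1ℚ         ≤⟨ *-monoˡ-≤-nonNeg (ι C) {{ι-nonNeg C}} 1≤pe ⟩
    ι C * (p * ι e)  ≡⟨ solve 3 (λ c p e → c :* (p :* e) := p :* (c :* e)) refl (ι C) p (ι e) ⟩
    p * (ι C * ι e)  ≡⟨ cong (p *_) (ι-* C e) ⟨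
    p * ι (C ℕ.* e)  <⟨ *-monoʳ-<-pos p {{positive 0<p}} (ι-mono-< Ce<M) ⟩
    p * ι M          ∎
    where
    open ≤-Reasoning
    open +-*-Solver

  -- Comparing `n` with a natural number equal to `n · α`.

  Comparable : ℝ → ℕ → Set
  Comparable α c = ∀ n k → fromℕ k ≃ n · α → n ℕ.≤ c ℕ.* k × k ℕ.≤ c ℕ.* n

  comparable-mono : ∀ {α c d} → c ℕ.≤ d → Comparable α c → Comparable α d
  comparable-mono c≤d comp n k eq =
    let n≤ck , k≤cn = comp n k eq
    in ℕ.≤-trans n≤ck (ℕ.*-monoˡ-≤ k c≤d) , ℕ.≤-trans k≤cn (ℕ.*-monoˡ-≤ n c≤d)

  -- A positive lower bound `δ` for `α` gives `n ≤ suc q * k` with `suc q ≥ 1/δ`, and an upper bound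
  -- `A` on a tail of the Cauchy sequence gives `k ≤ A * n`; the sum of the two constants serves
  -- both.
  comparable : ∀ α → 0<ℝ α → ∃[ c ] Comparable α c
  comparable α (δ , 0<δ , N₁ , δ≤α) = suc q ℕ.+ A , λ n k eq →
    ( ℕ.≤-trans (n≤ n k eq) (ℕ.*-monoˡ-≤ k (ℕ.m≤m+n (suc q) A))
    , ℕ.≤-trans (≤n n k eq) (ℕ.*-monoˡ-≤ n (ℕ.m≤n+m A (suc q))) )
    where
    open ≤-Reasoning
    open +-*-Solver
    q = proj₁ (1≤p*ι δ 0<δ)
    1≤δq = proj₂ (1≤p*ι δ 0<δ)
    near = cauchy α 1ℚ (positive⁻¹ 1ℚ)
    N₂ = proj₁ near
    A = proj₁ (∃p≤ι (seq α N₂ + 1ℚ))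

    α≤A : ∀ i → N₂ ℕ.≤ i → seq α i ≤ ι A
    α≤A i N₂≤i = ≤-trans (<⇒≤ (∣p-q∣<r⇒p<q+r (proj₂ near i N₂ N₂≤i ℕ.≤-refl)))
                         (proj₂ (∃p≤ι (seq α N₂ + 1ℚ)))

    n≤ : ∀ n k → fromℕ k ≃ n · α → n ℕ.≤ suc q ℕ.* k
    n≤ zero    k eq = ℕ.z≤n
    n≤ (suc n) k eq = subst (n ℕ.<_) (ℕ.*-comm k (suc q)) (ι-cancel-< (begin-strict
      ι n                     ≡⟨ *-identityʳ (ι n) ⟨
      ι n * 1ℚ                ≤⟨ *-monoˡ-≤-nonNeg (ι n) {{ι-nonNeg n}} 1≤δq ⟩
      ι n * (δ * ι (suc q))   ≡⟨ *-assoc (ι n) δ (ι (suc q)) ⟨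
      ι n * δ * ι (suc q)     <⟨ *-monoˡ-<-pos (ι (suc q)) {{ι-pos (suc q)}} nδ<k ⟩
      ι k * ι (suc q)         ≡⟨ ι-* k (suc q) ⟨
      ι (k ℕ.* suc q)         ∎))
      where
      -- With tolerance `δ`, `k` exceeds `suc n * δ - δ = n * δ`; the strict `n < suc q * k` that
      -- follows recovers the lost unit.
      close = eq δ 0<δ
      i = proj₁ close ℕ.⊔ N₁
      δ≤αᵢ : δ ≤ seq α i
      δ≤αᵢ = δ≤α i (ℕ.m≤n⊔m (proj₁ close) N₁)
      near-k : ∣ ι k - ι (suc n) * seq α i ∣ < δ
      near-k = proj₂ close i (ℕ.m≤m⊔n (proj₁ close) N₁)
      nδ<k : ι n * δ < ι k
      nδ<k = begin-strict
        ι n * δ                     ≡⟨ solve 2 (λ n d → n :* d := (con 1ℚ :+ n) :* d :- d) refl (ι n) δ ⟩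
        (ι 1 + ι n) * δ - δ         ≡⟨ cong (λ t → t * δ - δ) (ι-+ 1 n) ⟨
        ι (suc n) * δ - δ           ≤⟨ +-monoˡ-≤ (- δ) (*-monoˡ-≤-nonNeg (ι (suc n)) {{ι-nonNeg (suc n)}} δ≤αᵢ) ⟩
        ι (suc n) * seq α i - δ     <⟨ +-monoˡ-< (- δ) (∣p-q∣<r⇒q<p+r {ι k} {ι (suc n) * seq α i} near-k) ⟩
        ι k + δ - δ                 ≡⟨ solve 2 (λ k d → k :+ d :- d := k) refl (ι k) δ ⟩
        ι k                         ∎

    ≤n : ∀ n k → fromℕ k ≃ n · α → k ℕ.≤ A ℕ.* n
    ≤n n k eq = subst (k ℕ.≤_) (ℕ.*-comm n A)
      (ℕ.s≤s⁻¹ (subst (k ℕ.<_) (ℕ.+-comm (n ℕ.* A) 1) (ι-cancel-< k<nA+1)))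
      where
      -- Tolerance 1 gives `k < n * A + 1`, which for naturals means `k ≤ n * A`.
      close = eq 1ℚ (positive⁻¹ 1ℚ)
      i = proj₁ close ℕ.⊔ N₂
      αᵢ≤A : seq α i ≤ ι A
      αᵢ≤A = α≤A i (ℕ.m≤n⊔m (proj₁ close) N₂)
      k<nA+1 : ι k < ι (n ℕ.* A ℕ.+ 1)
      k<nA+1 = begin-strict
        ι k                  <⟨ ∣p-q∣<r⇒p<q+r (proj₂ close i (ℕ.m≤m⊔n (proj₁ close) N₂)) ⟩
        ι n * seq α i + 1ℚ   ≤⟨ +-monoˡ-≤ 1ℚ (*-monoˡ-≤-nonNeg (ι n) {{ι-nonNeg n}} αᵢ≤A) ⟩
        ι n * ι A + ι 1      ≡⟨ cong (_+ ι 1) (ι-* n A) ⟨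
        ι (n ℕ.* A) + ι 1    ≡⟨ ι-+ (n ℕ.* A) 1 ⟨
        ι (n ℕ.* A ℕ.+ 1)    ∎

  -- By monotonicity the maximum of the finitely many witnesses serves every index.
  common : ∀ {S} {P : Fin S → ℕ → Set} → (∀ {j c d} → c ℕ.≤ d → P j c → P j d) →
           (∀ j → ∃[ c ] P j c) → ∃[ c ] ∀ j → P j c
  common {zero}  mono each = 0 , λ ()
  common {suc S} mono each with each zero | common {S} (λ {j} → mono {suc j}) (λ j → each (suc j))
  ... | a , Pa | b , Pb = a ℕ.⊔ b , λ where
    zero    → mono (ℕ.m≤m⊔n a b) Pa
    (suc j) → mono (ℕ.m≤n⊔m a b) (Pb j)

-- Choice of the threshold for `ε`.

open Naturals
open Rationals

mainTheorem16 : (S : ℕ) (2≤S : 2 ℕ.≤ S) (α : Fin S → ℝ) → (∀ j → 0<ℝ α j) →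
    ∀ (ε : ℚ) → 0ℚ < ε → ∃[ N ] ∀ (n : ℕ) → N ℕ.≤ n →
    ∀ (m : Vec ℕ S) (m≢0 : All ℕ.NonZero m) → (∀ j → fromℕ (lookup m j) ≃ n · α j) →
    ∣ (B m ÷ mainTerm 2≤S m m≢0) {{mainTerm≢0 2≤S m m≢0}} - 1ℚ ∣ < ε
-- The threshold exceeds `c * (C * suc e)` with `suc e ≥ 1/ε`. As `n ≤ c * sum m`, cancelling `c`
-- leaves `C * suc e < sum m`, hence `C < ε * sum m`.
mainTheorem16 S 2≤S α α>0 ε 0<ε = ℕ.suc (c ℕ.* (C ℕ.* ℕ.suc e)) , λ n N≤n m m≢0 m≃nα →
  let n≤cm = All.lookup⁻ λ j → proj₁ (compare j n (lookup m j) (m≃nα j))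
      m≤cn = All.lookup⁻ λ j → proj₂ (compare j n (lookup m j) (m≃nα j))
      Ce<M = ℕ.*-cancelˡ-< c _ _ (ℕ.≤-trans N≤n (n≤c*sum m 2≤S n≤cm))
  in ratio-bound 2≤S m m≢0 {c = c} n≤cm m≤cn (1≤p*ι⇒ι<p*ι (ℕ.suc e) C (sum m) 1≤εe Ce<M 0<ε)
  where
  comparison = common {P = λ j → Comparable (α j)} (λ {j} → comparable-mono {α j})
    (λ j → comparable (α j) (α>0 j))
  c = proj₁ comparison
  compare = proj₂ comparison
  C = relativeError S c
  e = proj₁ (1≤p*ι ε 0<ε)
  1≤εe = proj₂ (1≤p*ι ε 0<ε)
  n≤c*sum : ∀ {S n} (m : Vec ℕ S) → 2 ℕ.≤ S → All (λ k → n ℕ.≤ c ℕ.* k) m → n ℕ.≤ c ℕ.* sum m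
  n≤c*sum (k ∷ m) _ (n≤ck ∷ _) = ℕ.≤-trans n≤ck (ℕ.*-monoʳ-≤ c (ℕ.m≤m+n k (sum m)))
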